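{- Let $n \ge 2$ and let $X = \{\sigma_{i_1},\ldots,\sigma_{i_k}\}$ be a nonempty subset of the set $A(B_n)=\{\sigma_1,\ldots,\sigma_{n-1}\}$ of atoms of the lattice $B_n$, where $1 \le i_1 < \cdots < i_k \le n-1$. Assume that $\bigvee X = \widehat{1}$ in $B_n$. Then, with respect to the total order $\sigma_1 \lhd \sigma_2 \lhd \cdots \lhd \sigma_{n-1}$, $X$ is NBB if and only if both of the following hold: (1) $i_1 = 1$; (2) $\{i_2-1, i_3-1, \ldots, i_k-1\}$ is a sparse set of $[n-2]$.
   Context: For $\sigma \in S_n$ let $\mathrm{Inv}(\sigma) = \{(i,j) : 1 \le i<j\le n,\ \sigma(i)>\sigma(j)\}$. The weak order on $S_n$ is defined by $\sigma \le \tau$ iff $\mathrm{Inv}(\sigma) \subseteq \mathrm{Inv}(\tau)$. $B'_n$ is the set of 321-avoiding permutations in $S_n$ (those with no $i<j<k$ such that $\sigma(i)>\sigma(j)>\sigma(k)$), with the order induced from the weak order; $B_n := B'_n \cup \{\widehat{1}\}$, where $\widehat{1}$ is a new element adjoined strictly above all elements of $B'_n$. $B_n$ is a finite lattice whose minimum is the identity permutation. Its atoms are the adjacent transpositions $\sigma_i := (i,i+1)$, $1 \le i \le n-1$. Given a total order $\lhd$ on the set of atoms of a finite lattice $L$, a nonempty set $D$ of atoms is bounded below (BB) if for every $d \in D$ there is an atom $a$ of $L$ with $a \lhd d$ (strictly) and $a < \bigvee D$ in $L$. A set $B$ of atoms is NBB if it does not contain any bounded below subset $D \subseteq B$. For $m\ge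 0$, $[m] = \{1,\ldots,m\}$ (with $[0]=\emptyset$). A subset $S \subseteq [m]$ is a sparse set if $1 \in S$ and, whenever $i \in S$ with $1 \le i \le m-1$, $i+1 \notin S$. In particular the empty set is not sparse. -}

module Defs where

open import Level using (Level; 0ℓ; _⊔_) renaming (suc to lsuc)
open import Data.Nat.Base as ℕ using (ℕ; zero; suc; _∸_; z≤n)
import Data.Nat.Properties as ℕ
open import Data.Fin.Base using (Fin; zero; suc; toℕ; inject₁; _<_; _≤_)
open import Data.Fin.Properties as Fin using (_≟_; toℕ-inject₁; <-cmp)
open import Data.Fin.Induction using (<-weakInduction)
open import Data.Fin.Permutation using (Permutation′; _⟨$⟩ʳ_; _⟨$⟩ˡ_; inverseˡ; inverseʳ; transpose) renaming (_≈_ to _≈ₚ_)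
open import Data.List.Base using (List)
open import Data.List.Relation.Unary.Any using (Any)
open import Data.Product.Base using (_×_; _,_; ∃-syntax; ∃₂; proj₁; proj₂)
open import Data.Empty using (⊥-elim)
open import Relation.Nullary using (¬_; yes; no)
open import Relation.Unary using (Pred; _∈_; _∉_; _⊆_; Satisfiable)
open import Relation.Binary.Core using (Rel)
open import Relation.Binary.Bundles using (Poset)
open import Relation.Binary.Structures using (IsPartialOrder)
open import Relation.Binary.Definitions using (Minimum; Antisymmetric; tri<; tri≈; tri>)
open import Relation.Binary.PropositionalEquality using (_≡_; refl; sym; trans; cong; subst; subst₂)
open import Relation.Nullary.Construct.Add.Supremum using (_⁺; ⊤⁺; [_])
import Relation.Binary.Construct.Add.Supremum.Equality as SupEquality
import Relation.Binary.Construct.Add.Supremum.NonStrict as SupOrder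
import Relation.Binary.Properties.Poset as PosetProperties

private
  variable
    m n : ℕ

module Order {c ℓ₁ ℓ₂ : Level} (P : Poset c ℓ₁ ℓ₂) where

  open Poset P using (Carrier) renaming (_≤_ to _⊑_)
  open PosetProperties P using () renaming (_<_ to _⊏_)

  record IsJoin {ℓ : Level} (D : Pred Carrier ℓ) (s : Carrier) : Set (c ⊔ ℓ₂ ⊔ ℓ) where
    field
      upper : ∀ {d} → d ∈ D → d ⊑ s
      least : ∀ {u} → (∀ {d} → d ∈ D → d ⊑ u) → s ⊑ u

  record IsAtom (a : Carrier) : Set (c ⊔ ℓ₁ ⊔ ℓ₂) where
    field
      bot         : Carrier
      bot-minimum : Minimum _⊑_ bot
      bot⊏a       : bot ⊏ a
      covers      : ∀ {x} → bot ⊏ x → ¬ (x ⊏ a)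

  -- `_◁_` is meant to be the strict form of a total order on the atoms.  The
  -- join of a set is unique up to `_≈_` and always exists when P is a finite
  -- lattice, so `join` below is the element ⋁ D.
  module _ {ℓ◁ : Level} (_◁_ : Rel Carrier ℓ◁) where

    record BoundedBelow {ℓ : Level} (D : Pred Carrier ℓ) : Set (c ⊔ ℓ₁ ⊔ ℓ₂ ⊔ ℓ◁ ⊔ ℓ) where
      field
        nonempty : Satisfiable D
        atoms    : D ⊆ IsAtom
        join     : Carrier
        isJoin   : IsJoin D join
        bounded  : ∀ {d} → d ∈ D → ∃[ a ] (IsAtom a × a ◁ d × a ⊏ join)

    record NBB {ℓ : Level} (B : Pred Carrier ℓ) : Set (c ⊔ ℓ₁ ⊔ ℓ₂ ⊔ ℓ◁ ⊔ lsuc ℓ) where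
      field
        atoms : B ⊆ IsAtom
        noBB  : (D : Pred Carrier ℓ) → D ⊆ B → ¬ BoundedBelow D

Inv : Permutation′ n → Pred (Fin n × Fin n) 0ℓ
Inv σ (i , j) = i < j × σ ⟨$⟩ʳ j < σ ⟨$⟩ʳ i

_≤ʷ_ : Rel (Permutation′ n) 0ℓ
σ ≤ʷ τ = Inv σ ⊆ Inv τ

Avoids321 : Permutation′ n → Set
Avoids321 {n} σ = ¬ (∃[ i ] ∃[ j ] ∃[ k ]
  (i < j × j < k × σ ⟨$⟩ʳ j < σ ⟨$⟩ʳ i × σ ⟨$⟩ʳ k < σ ⟨$⟩ʳ j))

private
  injective : (σ : Permutation′ n) {i j : Fin n} → σ ⟨$⟩ʳ i ≡ σ ⟨$⟩ʳ j → i ≡ j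
  injective σ eq = trans (sym (inverseˡ σ)) (trans (cong (σ ⟨$⟩ˡ_) eq) (inverseˡ σ))

  increasing⇒inflationary : (f : Fin n → Fin n) → (∀ {a b} → a < b → f a < f b) → ∀ a → a ≤ f a
  increasing⇒inflationary {suc _} f mono = <-weakInduction (λ a → a ≤ f a) z≤n step
    where
    step : ∀ i → inject₁ i ≤ f (inject₁ i) → suc i ≤ f (suc i)
    step i le = ℕ.≤-<-trans (subst (ℕ._≤ toℕ (f (inject₁ i))) (toℕ-inject₁ i) le)
                            (mono {inject₁ i} {suc i} (ℕ.s≤s (ℕ.≤-reflexive (toℕ-inject₁ i))))

  Inv≡⇒increasing : (σ τ : Permutation′ n) → σ ≤ʷ τ → τ ≤ʷ σ → ∀ {i j} → σ ⟨$⟩ʳ i < σ ⟨$⟩ʳ j → τ ⟨$⟩ʳ i < τ ⟨$⟩ʳ j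
  Inv≡⇒increasing σ τ σ≤τ τ≤σ {i} {j} lt with <-cmp i j
  ... | tri≈ _ refl _ = ⊥-elim (ℕ.<-irrefl refl lt)
  ... | tri> _ _ j<i  = proj₂ (σ≤τ {j , i} (j<i , lt))
  ... | tri< i<j i≢j _ with <-cmp (τ ⟨$⟩ʳ i) (τ ⟨$⟩ʳ j)
  ...   | tri< lt′ _ _ = lt′
  ...   | tri≈ _ eq _  = ⊥-elim (i≢j (injective τ eq))
  ...   | tri> _ _ gt  = ⊥-elim (ℕ.<-asym lt (proj₂ (τ≤σ {i , j} (i<j , gt))))

  inflationary-on : (σ τ : Permutation′ n) → σ ≤ʷ τ → τ ≤ʷ σ → ∀ i → σ ⟨$⟩ʳ i ≤ τ ⟨$⟩ʳ i
  inflationary-on σ τ σ≤τ τ≤σ i =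
    subst (λ k → σ ⟨$⟩ʳ i ≤ τ ⟨$⟩ʳ k) (inverseˡ σ)
      (increasing⇒inflationary (λ a → τ ⟨$⟩ʳ (σ ⟨$⟩ˡ a))
        (λ lt → Inv≡⇒increasing σ τ σ≤τ τ≤σ (subst₂ _<_ (sym (inverseʳ σ)) (sym (inverseʳ σ)) lt))
        (σ ⟨$⟩ʳ i))

≤ʷ-antisym : Antisymmetric (_≈ₚ_ {n} {n}) _≤ʷ_
≤ʷ-antisym {i = σ} {j = τ} σ≤τ τ≤σ i =
  Fin.≤-antisym (inflationary-on σ τ σ≤τ τ≤σ i) (inflationary-on τ σ τ≤σ σ≤τ i)

≤ʷ-reflexive : {σ τ : Permutation′ n} → σ ≈ₚ τ → σ ≤ʷ τ
≤ʷ-reflexive eq (i<j , gt) = i<j , subst₂ _<_ (eq _) (eq _) gt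

record B′ (n : ℕ) : Set where
  constructor _,_
  field
    perm      : Permutation′ n
    avoids321 : Avoids321 perm

open B′ public

_≈′_ : Rel (B′ n) 0ℓ
x ≈′ y = perm x ≈ₚ perm y

_≤′_ : Rel (B′ n) 0ℓ
x ≤′ y = perm x ≤ʷ perm y

≤′-isPartialOrder : IsPartialOrder (_≈′_ {n}) _≤′_
≤′-isPartialOrder = record
  { isPreorder = record
    { isEquivalence = record
      { refl  = λ _ → refl
      ; sym   = λ eq i → sym (eq i)
      ; trans = λ eq eq′ i → trans (eq i) (eq′ i)
      }
    ; reflexive = λ {x} {y} → ≤ʷ-reflexive {σ = perm x} {τ = perm y}
    ; trans     = λ p q {ij} r → q {ij} (p {ij} r)
    }
  ; antisym = λ {x} {y} → ≤ʷ-antisym {i = perm x} {j = perm y}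
  }

-- The adjoined top element 1̂ is ⊤⁺.
B : ℕ → Poset 0ℓ 0ℓ 0ℓ
B n = record
  { Carrier        = B′ n ⁺
  ; _≈_            = SupEquality._≈⁺_ _≈′_
  ; _≤_            = SupOrder._≤⁺_ _≤′_
  ; isPartialOrder = SupOrder.≤⁺-isPartialOrder _≤′_ ≤′-isPartialOrder
  }

-- Element i of Fin (n ∸ 1) stands for the index `label i` in {1, …, n-1}.
label : Fin m → ℕ
label i = suc (toℕ i)

adjacent : Fin (n ∸ 1) → Permutation′ n
adjacent {suc _} i = transpose (inject₁ i) (suc i)

Inv-adjacent : (p : Fin m) {i j : Fin (suc m)} → Inv (adjacent {suc m} p) (i , j) → i ≡ inject₁ p × j ≡ suc p
Inv-adjacent p {i} {j} (i<j , gt) with i ≟ inject₁ p | j ≟ inject₁ p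
Inv-adjacent p {i} {j} (i<j , gt) | yes refl | yes refl = ⊥-elim (ℕ.<-irrefl refl i<j)
Inv-adjacent p {i} {j} (i<j , gt) | yes refl | no _ with j ≟ suc p
... | yes refl = refl , refl
... | no _ = ⊥-elim (ℕ.<⇒≱ gt (subst (ℕ._≤ toℕ j) (cong suc (toℕ-inject₁ p)) i<j))
Inv-adjacent p {i} {j} (i<j , gt) | no _ | yes refl with i ≟ suc p
... | yes refl = ⊥-elim (ℕ.<⇒≱ i<j (ℕ.≤-trans (ℕ.≤-reflexive (toℕ-inject₁ p)) (ℕ.n≤1+n _)))
... | no _ = ⊥-elim (ℕ.<-asym gt (ℕ.<-trans i<j (ℕ.s≤s (ℕ.≤-reflexive (toℕ-inject₁ p)))))
Inv-adjacent p {i} {j} (i<j , gt) | no _ | no j≢ with i ≟ suc p | j ≟ suc p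
... | yes refl | yes refl = ⊥-elim (ℕ.<-irrefl refl i<j)
... | yes refl | no _ = ⊥-elim (ℕ.<-asym gt (ℕ.<-trans (ℕ.s≤s (ℕ.≤-reflexive (toℕ-inject₁ p))) i<j))
Inv-adjacent p {i} {j} (i<j , gt) | no i≢ | no _ | no _ | yes refl =
  ⊥-elim (i≢ (Fin.toℕ-injective (ℕ.≤-antisym
    (ℕ.≤-trans (ℕ.s≤s⁻¹ i<j) (ℕ.≤-reflexive (sym (toℕ-inject₁ p)))) (ℕ.<⇒≤ gt))))
Inv-adjacent p {i} {j} (i<j , gt) | no _ | no _ | no _ | no _ = ⊥-elim (ℕ.<-asym i<j gt)

adjacent-avoids321 : (p : Fin (n ∸ 1)) → Avoids321 (adjacent {n} p)
adjacent-avoids321 {suc m} p (i , j , k , i<j , j<k , gt₁ , gt₂)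
  with trans (sym (proj₂ (Inv-adjacent p {i} {j} (i<j , gt₁)))) (proj₁ (Inv-adjacent p {j} {k} (j<k , gt₂)))
... | eq = ℕ.1+n≢n (trans (cong toℕ eq) (toℕ-inject₁ p))

atom : Fin (n ∸ 1) → B′ n ⁺
atom {n} i = [ adjacent {n} i , adjacent-avoids321 {n} i ]

_◁_ : Rel (B′ n ⁺) 0ℓ
_◁_ {n} x y = ∃₂ λ i j → x ≈ atom i × y ≈ atom j × i < j
  where open Poset (B n) using (_≈_)

atomSet : List (Fin (n ∸ 1)) → Pred (B′ n ⁺) 0ℓ
atomSet {n} is x = Any (λ i → x ≈ atom i) is
  where open Poset (B n) using (_≈_)

record Sparse (m : ℕ) (S : Pred ℕ 0ℓ) : Set where
  field
    subset : ∀ {i} → i ∈ S → 1 ℕ.≤ i × i ℕ.≤ m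
    one    : 1 ∈ S
    gap    : ∀ {i} → i ∈ S → 1 ℕ.≤ i → i ℕ.≤ m ∸ 1 → suc i ∉ S

shifted : List (Fin m) → Pred ℕ 0ℓ
shifted is j = Any (λ i → j ≡ label i ∸ 1) is

{-# OPTIONS --safe #-}
-- Two consecutive atoms σₖ, σₖ₊₁ have only 1̂ as an upper bound, since a
-- permutation above both has a 321 pattern.  If a set of indices has no two
-- consecutive elements, then the product of its (commuting) transpositions
-- avoids 321, and the atoms below it are exactly its factors.  So a set of
-- atoms is bounded below iff it contains two consecutive atoms but not σ₁.
-- Hence X is NBB iff X ∖ {σ₁} has no consecutive atoms; as ⋁ X = 1̂, X itself
-- has some, and these must be σ₁ and σ₂.
module Submission where

open import Defs
open import Level using (0ℓ)
open import Data.Bool.Base using (if_then_else_)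
open import Data.Nat.Base as ℕ using (ℕ; zero; suc; _≤_; _∸_; z≤n; s≤s)
import Data.Nat.Properties as ℕ
open import Data.Fin.Base using (Fin; zero; suc; toℕ; inject₁; _<_)
open import Data.Fin.Properties using (_≟_; _<?_; toℕ-inject₁; toℕ-injective; toℕ<n; <-trans)
open import Data.Fin.Induction using (<-wellFounded)
open import Data.Fin.Permutation using (Permutation′; _⟨$⟩ʳ_; id; lift₀; swap)
open import Data.List.Base using (List; _∷_)
open import Data.List.Relation.Unary.All as All using ()
open import Data.List.Relation.Unary.Any as Any using (here; there)
open import Data.List.Relation.Unary.Linked using (Linked; _∷_)
open import Data.List.Relation.Unary.Linked.Properties using (Linked⇒All)
open import Data.Product.Base using (_×_; _,_; proj₁; proj₂; ∃-syntax)
open import Function.Base using (_∘_)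
open import Function.Bundles using (_⇔_; mk⇔)
open import Induction.WellFounded using (Acc; acc)
open import Relation.Nullary using (¬_; does; yes; no; contradiction)
open import Relation.Nullary.Decidable using (decidable-stable; _×-dec_; ¬?)
open import Relation.Unary using (Pred; Decidable; _∈_; _⊆_)
open import Relation.Binary.Bundles using (Poset)
open import Relation.Binary.PropositionalEquality using (_≡_; _≢_; refl; sym; trans; cong; subst)
open import Relation.Nullary.Construct.Add.Supremum using (_⁺; ⊤⁺; [_])
import Relation.Binary.Construct.Add.Supremum.NonStrict as ≤⁺

private
  variable
    m n : ℕ
    P : Pred ℕ 0ℓ

-- Products of commuting adjacent transpositions.

NoConsecutive : Pred ℕ 0ℓ → Set
NoConsecutive P = ∀ {k} → P k → ¬ P (suc k)

-- The product of the adjacent transpositions with 0-based index in P, scanning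
-- from the left; an index directly after a used one is skipped.
product : ∀ n → Decidable P → Permutation′ n
product zero P? = id
product (suc zero) P? = id
product (suc (suc n)) P? =
  if does (P? 0) then swap (product n (P? ∘ (2 ℕ.+_))) else lift₀ (product (suc n) (P? ∘ suc))

-- After a used index, `swap` steps over the next one untested; by `nc` that one is not in `P`, so
-- no inversion is lost.
product-Inv⁺ : (P? : Decidable P) → NoConsecutive P → (p : Fin m) → P (toℕ p) →
               product (suc m) P? ⟨$⟩ʳ suc p < product (suc m) P? ⟨$⟩ʳ inject₁ p
product-Inv⁺ P? nc zero P0 with P? 0
... | yes _  = s≤s z≤n
... | no ¬P0 = contradiction P0 ¬P0
product-Inv⁺ P? nc (suc p) Pp with P? 0
product-Inv⁺ P? nc (suc p)       Pp | no _   = s≤s (product-Inv⁺ (P? ∘ suc) nc p Pp)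
product-Inv⁺ P? nc (suc zero)    P1 | yes P0 = contradiction P1 (nc P0)
product-Inv⁺ P? nc (suc (suc p)) Pp | yes _  = s≤s (s≤s (product-Inv⁺ (P? ∘ (2 ℕ.+_)) nc p Pp))

-- `lift₀` creates no inversion and `swap` only the pair (0, 1): both map the initial block to
-- itself, below all later values.
product-Inv⁻ : ∀ n (P? : Decidable P) {i j} → (i , j) ∈ Inv (product n P?) →
               P (toℕ i) × toℕ j ≡ suc (toℕ i)
product-Inv⁻ (suc zero) P? {zero} {zero} (() , _)
product-Inv⁻ (suc (suc n)) P? {i} {j} inv with P? 0
product-Inv⁻ (suc (suc n)) P? {zero}        {_}           (_ , ())           | no _
product-Inv⁻ (suc (suc n)) P? {suc i}       {suc j}       (s≤s i<j , s≤s gt) | no _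
  with product-Inv⁻ (suc n) (P? ∘ suc) (i<j , gt)
... | Pi , eq = Pi , cong suc eq
product-Inv⁻ (suc (suc n)) P? {zero}        {suc zero}    _                  | yes P0 = P0 , refl
product-Inv⁻ (suc (suc n)) P? {zero}        {suc (suc j)} (_ , s≤s ())       | yes _
product-Inv⁻ (suc (suc n)) P? {suc zero}    {suc zero}    (s≤s () , _)       | yes _
product-Inv⁻ (suc (suc n)) P? {suc zero}    {suc (suc j)} (_ , ())           | yes _
product-Inv⁻ (suc (suc n)) P? {suc (suc i)} {suc zero}    (s≤s () , _)       | yes _
product-Inv⁻ (suc (suc n)) P? {suc (suc i)} {suc (suc j)} (s≤s (s≤s i<j) , s≤s (s≤s gt)) | yes _
  with product-Inv⁻ n (P? ∘ (2 ℕ.+_)) (i<j , gt)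
... | Pi , eq = Pi , cong (2 ℕ.+_) eq

product-avoids321 : (P? : Decidable P) → NoConsecutive P → Avoids321 (product n P?)
product-avoids321 {P} {n} P? nc (i , j , k , i<j , j<k , gt₁ , gt₂)
  with product-Inv⁻ n P? (i<j , gt₁) | product-Inv⁻ n P? (j<k , gt₂)
... | Pi , eq | Pj , _ = nc Pi (subst P eq Pj)

inject₁<suc : (p : Fin m) → inject₁ p < suc p
inject₁<suc p = s≤s (ℕ.≤-reflexive (toℕ-inject₁ p))

adjacent-Inv : (p : Fin m) → (inject₁ p , suc p) ∈ Inv (adjacent {suc m} p)
adjacent-Inv p = inject₁<suc p , gt
  where
  gt : adjacent p ⟨$⟩ʳ suc p < adjacent p ⟨$⟩ʳ inject₁ p
  gt with inject₁ p ≟ inject₁ p | suc p ≟ inject₁ p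
  ... | no ≢p | _      = contradiction refl ≢p
  ... | yes _ | yes eq = contradiction (trans (cong toℕ eq) (toℕ-inject₁ p)) ℕ.1+n≢n
  -- The test left in `transpose` is `suc p ≟ suc p`, which is decided through `p ≟ p`.
  ... | yes _ | no _ with p ≟ p
  ...   | yes _ = inject₁<suc p
  ...   | no ≢p = contradiction refl ≢p

-- Atoms and their upper bounds.

module _ {m : ℕ} where

  open Poset (B (suc m)) using (_≈_; antisym; module Eq) renaming (_≤_ to _⊑_; trans to ⊑-trans; reflexive to ⊑-reflexive)
  open Order (B (suc m))

  σ : Fin m → B′ (suc m) ⁺
  σ = atom {suc m}

  -- `adjacent p` has a single inversion, so lying above `σ p` is a condition on one pair of
  -- positions.
  σ⊑⁺ : ∀ {p τ} → (inject₁ p , suc p) ∈ Inv (perm τ) → σ p ⊑ [ τ ]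
  σ⊑⁺ {p} {τ} inv = ≤⁺.[ (λ {ij} r → below ij r) ]
    where
    below : ∀ ij → ij ∈ Inv (adjacent {suc m} p) → ij ∈ Inv (perm τ)
    below (i , j) r with Inv-adjacent p {i} {j} r
    ... | refl , refl = inv

  σ⊑⁻ : ∀ {p τ} → σ p ⊑ [ τ ] → (inject₁ p , suc p) ∈ Inv (perm τ)
  σ⊑⁻ {p} ≤⁺.[ le ] = le {inject₁ p , suc p} (adjacent-Inv p)

  σ-injective : ∀ {p q} → σ p ≈ σ q → p ≡ q
  σ-injective {p} {q} eq = toℕ-injective (ℕ.suc-injective (cong toℕ
    (proj₂ (Inv-adjacent q (σ⊑⁻ {p} (⊑-reflexive eq))))))

  σ-isAtom : ∀ {x} p → x ≈ σ p → IsAtom x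
  σ-isAtom {x} p x≈σ = record
    { bot         = ⊥B
    ; bot-minimum = minimum
    ; bot⊏a       = minimum x , λ ⊥≈x → ⊥⋣σ (⊑-reflexive (Eq.sym (Eq.trans ⊥≈x x≈σ)))
    ; covers      = λ {y} ⊥⊏y y⊏x → noneBetween {y} ⊥⊏y
        (⊑-trans (proj₁ y⊏x) (⊑-reflexive x≈σ)) (λ y≈σ → proj₂ y⊏x (Eq.trans y≈σ (Eq.sym x≈σ)))
    }
    where
    ⊥B : B′ (suc m) ⁺
    ⊥B = [ id , (λ (_ , _ , _ , i<j , _ , gt , _) → ℕ.<-asym i<j gt) ]

    minimum : ∀ y → ⊥B ⊑ y
    minimum ⊤⁺    = _ ≤⁺.≤⊤⁺
    minimum [ τ ] = ≤⁺.[ (λ (i<j , gt) → contradiction gt (ℕ.<-asym i<j)) ]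

    ⊥⋣σ : ¬ (σ p ⊑ ⊥B)
    ⊥⋣σ le with σ⊑⁻ {p} le
    ... | i<j , gt = ℕ.<-asym i<j gt

    noneBetween : ∀ {y} → (⊥B ⊑ y) × ¬ (⊥B ≈ y) → y ⊑ σ p → ¬ ¬ (y ≈ σ p)
    noneBetween {[ τ ]} (⊥⊑y , ⊥≉y) y⊑σ@(≤⁺.[ le ]) y≉σ
      -- The only possible inversion of `τ` is that of `σ p`; if present, `τ` is `σ p`, and
      -- otherwise it is the identity.
      with perm τ ⟨$⟩ʳ suc p <? perm τ ⟨$⟩ʳ inject₁ p
    ... | yes gt = y≉σ (antisym y⊑σ (σ⊑⁺ {p} {τ} (inject₁<suc p , gt)))
    ... | no ¬gt = ⊥≉y (antisym ⊥⊑y ≤⁺.[ (λ {ij} r → contradiction r (empty ij)) ])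
      where
      empty : ∀ ij → ¬ (ij ∈ Inv (perm τ))
      empty (i , j) r with Inv-adjacent p {i} {j} (le {i , j} r)
      ... | refl , refl = ¬gt (proj₂ r)

  module _ (P? : Decidable P) (nc : NoConsecutive P) where

    productB : B′ (suc m) ⁺
    productB = [ product (suc m) P? , product-avoids321 {n = suc m} P? nc ]

    σ⊑productB⁺ : ∀ {p} → P (toℕ p) → σ p ⊑ productB
    σ⊑productB⁺ {p} Pp = σ⊑⁺ {p} (inject₁<suc p , product-Inv⁺ P? nc p Pp)

    σ⊑productB⁻ : ∀ {p} → σ p ⊑ productB → P (toℕ p)
    σ⊑productB⁻ {p} le = subst P (toℕ-inject₁ p) (proj₁ (product-Inv⁻ (suc m) P? (σ⊑⁻ {p} le)))

  -- `label i ∸ 1` computes to `toℕ i`, so `shifted L` also serves as the set of 0-based indices of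
  -- the atoms in `L`.
  shifted? : (L : List (Fin m)) → Decidable (shifted L)
  shifted? L k = Any.any? (λ i → k ℕ.≟ toℕ i) L

  ∈atomSet⇒index : ∀ {L d} → d ∈ atomSet {suc m} L → ∃[ i ] (d ≈ σ i × shifted L (toℕ i))
  ∈atomSet⇒index (here d≈σ) = _ , d≈σ , here refl
  ∈atomSet⇒index (there d∈) with ∈atomSet⇒index d∈
  ... | i , d≈σ , i∈ = i , d≈σ , there i∈

  shifted⇒σ : ∀ {L k} → shifted L k → ∃[ i ] (k ≡ toℕ i × σ i ∈ atomSet {suc m} L)
  shifted⇒σ (here eq) = _ , eq , here Eq.refl
  shifted⇒σ (there k∈) with shifted⇒σ k∈
  ... | i , eq , σ∈ = i , eq , there σ∈

  atomSet⊆IsAtom : ∀ {L} → atomSet {suc m} L ⊆ IsAtom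
  atomSet⊆IsAtom d∈ with ∈atomSet⇒index d∈
  ... | i , d≈σ , _ = σ-isAtom i d≈σ

  consecutive⇒join≡⊤ : ∀ {L k} → shifted L k → shifted L (suc k) → IsJoin (atomSet {suc m} L) ⊤⁺
  consecutive⇒join≡⊤ {L} k∈ k+1∈ = record { upper = λ _ → _ ≤⁺.≤⊤⁺ ; least = least }
    where
    least : ∀ {u} → (∀ {d} → d ∈ atomSet {suc m} L → d ⊑ u) → ⊤⁺ ⊑ u
    least {⊤⁺}    _  = _ ≤⁺.≤⊤⁺
    least {[ τ ]} ub with shifted⇒σ k∈ | shifted⇒σ k+1∈
    ... | p , refl , σp∈ | q , eq , σq∈
      -- Since `q` directly follows `p`, `inject₁ q` is `suc p`: the two inversions share a position
      -- and chain into a 321 pattern.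
      with σ⊑⁻ {p} (ub σp∈)
         | subst (λ j → (j , suc q) ∈ Inv (perm τ))
                 (toℕ-injective (trans (toℕ-inject₁ q) (sym eq))) (σ⊑⁻ {q} (ub σq∈))
    ... | i<j , gt₁ | j<k , gt₂ = contradiction (_ , suc p , _ , i<j , j<k , gt₁ , gt₂) (avoids321 τ)

-- Joins equal to the top and bounded below sets.

noConsecutive⇒join≢⊤ : {L : List (Fin m)} → NoConsecutive (shifted L) →
                       ¬ Order.IsJoin (B (suc m)) (atomSet {suc m} L) ⊤⁺
noConsecutive⇒join≢⊤ {m} {L} nc isJoin with Order.IsJoin.least isJoin {productB (shifted? L) nc} ub
  where
  open Poset (B (suc m)) using () renaming (_≤_ to _⊑_; trans to ⊑-trans; reflexive to ⊑-reflexive)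
  ub : ∀ {d} → d ∈ atomSet {suc m} L → d ⊑ productB (shifted? L) nc
  ub d∈ with ∈atomSet⇒index d∈
  ... | i , d≈σ , i∈ = ⊑-trans (⊑-reflexive d≈σ) (σ⊑productB⁺ (shifted? L) nc {i} i∈)
... | ()

-- One witness serves every `d`: `σ zero` precedes all atoms of positive index and is strictly below
-- `⊤⁺`.
positive∧join≡⊤⇒boundedBelow : {i : Fin (suc m)} {L : List (Fin (suc m))} →
  (∀ {k} → shifted (i ∷ L) k → 0 ℕ.< k) →
  Order.IsJoin (B (suc (suc m))) (atomSet {suc (suc m)} (i ∷ L)) ⊤⁺ →
  Order.BoundedBelow (B (suc (suc m))) (_◁_ {suc (suc m)}) (atomSet {suc (suc m)} (i ∷ L))
positive∧join≡⊤⇒boundedBelow {m} {i} {L} pos isJoin = record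
  { nonempty = σ i , here Eq.refl
  ; atoms    = atomSet⊆IsAtom
  ; join     = ⊤⁺
  ; isJoin   = isJoin
  ; bounded  = λ d∈ → let (j , d≈σ , j∈) = ∈atomSet⇒index d∈ in
      σ zero , σ-isAtom zero Eq.refl , (zero , j , Eq.refl , d≈σ , pos j∈) , (_ ≤⁺.≤⊤⁺) , λ ()
  }
  where open Poset (B (suc (suc m))) using (module Eq)

NBB⇒noConsecutive : {i : Fin (suc m)} {is : List (Fin (suc m))} →
  (∀ {k} → shifted is k → 0 ℕ.< k) →
  Order.NBB (B (suc (suc m))) (_◁_ {suc (suc m)}) (atomSet {suc (suc m)} (i ∷ is)) →
  NoConsecutive (shifted is)
NBB⇒noConsecutive {is = _ ∷ _} pos nbb k∈ k+1∈ = Order.NBB.noBB nbb _ there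
  (positive∧join≡⊤⇒boundedBelow pos (consecutive⇒join≡⊤ k∈ k+1∈))

-- Infinite descent inside a bounded below D: the witness σⱼ ◁ d is below ⋁ D,
-- so σⱼ ∉ D is impossible, as then the product of the indices other than j
-- would be an upper bound of D.  (D need not be decidable.)
noConsecutive⇒NBB : {is : List (Fin m)} → NoConsecutive (shifted is) →
  ∀ {i} → toℕ i ≡ 0 →
  Order.NBB (B (suc m)) (_◁_ {suc m}) (atomSet {suc m} (i ∷ is))
noConsecutive⇒NBB {m} {is} nc {i} i≡0 = record { atoms = atomSet⊆IsAtom ; noBB = noBB }
  where
  open Poset (B (suc m)) using (_≈_; module Eq) renaming (_≤_ to _⊑_; trans to ⊑-trans; reflexive to ⊑-reflexive)
  open Order (B (suc m))

  noBB : (D : Pred (B′ (suc m) ⁺) 0ℓ) → D ⊆ atomSet {suc m} (i ∷ is) → ¬ BoundedBelow (_◁_ {suc m}) D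
  noBB D D⊆ bb = let (d , d∈D) = nonempty ; (k , d≈σ , _) = ∈atomSet⇒index (D⊆ d∈D) in
    σ∉D k (<-wellFounded k) d∈D d≈σ
    where
    open BoundedBelow bb
    open IsJoin isJoin using (least)

    σ∉D : ∀ k → Acc _<_ k → ∀ {d} → d ∈ D → ¬ (d ≈ σ k)
    σ∉D k (acc rec) d∈D d≈σk with bounded d∈D
    ... | a , _ , (j , k′ , a≈σj , d≈σk′ , j<k′) , (a⊑join , _) =
      proj₂ (σ⊑productB⁻ Q? ncQ {j} (⊑-trans (⊑-reflexive (Eq.sym a≈σj)) (⊑-trans a⊑join (least ub)))) refl
      where
      j<k : j < k
      -- `◁` supplies its own index `k′` for `d`; injectivity of `σ` identifies it with `k`.
      j<k = subst (j <_) (σ-injective (Eq.trans (Eq.sym d≈σk′) d≈σk)) j<k′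

      Q : Pred ℕ 0ℓ
      -- Only the tail is used, where `nc` applies; the last case of `ub` shows that `σ i` is not in
      -- `D`.
      Q l = shifted is l × l ≢ toℕ j

      Q? : Decidable Q
      Q? l = shifted? is l ×-dec ¬? (l ℕ.≟ toℕ j)

      ncQ : NoConsecutive Q
      ncQ (l∈ , _) (l+1∈ , _) = nc l∈ l+1∈

      ub : ∀ {e} → e ∈ D → e ⊑ productB Q? ncQ
      ub e∈D with ∈atomSet⇒index (D⊆ e∈D)
      ... | l , e≈σl , there l∈ = ⊑-trans (⊑-reflexive e≈σl) (σ⊑productB⁺ Q? ncQ {l}
        (l∈ , λ l≡j → σ∉D j (rec j<k) e∈D (subst (λ z → _ ≈ σ z) (toℕ-injective l≡j) e≈σl)))
      -- Here `e` is the first atom, and its witness would need an index below 0.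
      ... | l , e≈σl , here l≡i with bounded e∈D
      ...   | _ , _ , (j′ , l′ , _ , e≈σl′ , j′<l′) , _ =
        contradiction (subst (toℕ j′ ℕ.<_) (trans (cong toℕ (σ-injective (Eq.trans (Eq.sym e≈σl′) e≈σl)))
                                             (trans l≡i i≡0)) j′<l′) λ ()

-- Increasing index lists and sparse sets.

Linked⇒shifted> : {i : Fin m} {is : List (Fin m)} → Linked _<_ (i ∷ is) → ∀ {k} → shifted is k → toℕ i ℕ.< k
Linked⇒shifted> (i<j ∷ linked) k∈ with All.lookupAny (Linked⇒All <-trans i<j linked) k∈
... | i<l , k≡l = subst (_ ℕ.<_) (sym k≡l) i<l

shifted<m : {L : List (Fin m)} → ∀ {k} → shifted L k → k ℕ.< m
shifted<m (here {x = i} refl) = toℕ<n i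
shifted<m (there k∈)          = shifted<m k∈

theorem4p1 : (n : ℕ) → 2 ≤ n →
    (i₁ : Fin (n ∸ 1)) (is : List (Fin (n ∸ 1))) → Linked _<_ (i₁ ∷ is) →
    Order.IsJoin (B n) (atomSet {n} (i₁ ∷ is)) ⊤⁺ →
    Order.NBB (B n) (_◁_ {n}) (atomSet {n} (i₁ ∷ is)) ⇔ (label i₁ ≡ 1 × Sparse (n ∸ 2) (shifted is))
theorem4p1 (suc zero) (s≤s ())
theorem4p1 (suc (suc m)) _ i₁ is linked isJoin = mk⇔ to from
  where
  pos : ∀ {k} → shifted is k → 0 ℕ.< k
  pos = ℕ.≤-<-trans z≤n ∘ Linked⇒shifted> linked

  to : Order.NBB (B (suc (suc m))) _◁_ (atomSet {suc (suc m)} (i₁ ∷ is)) → label i₁ ≡ 1 × Sparse m (shifted is)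
  to nbb = cong suc i₁≡0 , record
    { subset = λ k∈ → pos k∈ , ℕ.s≤s⁻¹ (shifted<m k∈)
    -- Without 1 in the tail, the head 0 adds no consecutive pair, so the join could not be `⊤⁺`.
    ; one    = decidable-stable (shifted? is 1) λ 1∉ → noConsecutive⇒join≢⊤ (nc⁺ 1∉) isJoin
    ; gap    = λ k∈ _ _ → nc k∈
    }
    where
    nc : NoConsecutive (shifted is)
    nc = NBB⇒noConsecutive pos nbb

    i₁≡0 : toℕ i₁ ≡ 0
    i₁≡0 = decidable-stable (toℕ i₁ ℕ.≟ 0) λ i₁≢0 → Order.NBB.noBB nbb _ (λ d∈ → d∈)
      (positive∧join≡⊤⇒boundedBelow (λ { (here refl) → ℕ.n≢0⇒n>0 i₁≢0 ; (there k∈) → pos k∈ }) isJoin)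

    nc⁺ : ¬ shifted is 1 → NoConsecutive (shifted (i₁ ∷ is))
    nc⁺ 1∉ _          (here k+1≡i₁) = ℕ.1+n≢0 (trans k+1≡i₁ i₁≡0)
    nc⁺ 1∉ (here k≡i₁) (there k+1∈) = 1∉ (subst (shifted is ∘ suc) (trans k≡i₁ i₁≡0) k+1∈)
    nc⁺ 1∉ (there k∈)  (there k+1∈) = nc k∈ k+1∈

  from : label i₁ ≡ 1 × Sparse m (shifted is) → Order.NBB (B (suc (suc m))) _◁_ (atomSet {suc (suc m)} (i₁ ∷ is))
  from (label≡1 , sparse) = noConsecutive⇒NBB nc (ℕ.suc-injective label≡1)
    where
    open Sparse sparse
    nc : NoConsecutive (shifted is)
    -- `gap` asks for `k` at most `m ∸ 1`; this follows from the bound `m` on the member `suc k`.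
    nc k∈ k+1∈ = gap k∈ (pos k∈) (ℕ.<⇒≤pred (proj₂ (subset k+1∈))) k+1∈
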